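{- For the General Online Unbounded Knapsack Problem with Removal, the deterministic online algorithm Focus achieves a (strict) competitive ratio of at most $S_\infty$, where $S_\infty=\sum_{n=1}^{\infty}\frac{1}{a_n-1}<1.69104$.
   Context: Problem. An instance of the General Online Unbounded Knapsack Problem with Removal is a finite sequence of items $I=(x_1,\dots,x_n)$, where an item $x=(w,v)$ has a weight $w(x)=w\in(0,1]$ and a value $v(x)=v\in\mathbb{R}_{>0}$ (weights and values are arbitrary). A solution is a finite multiset $S$ of items from $I$ (each item may appear arbitrarily often) with $\sum_{x\in S}w(x)\le 1$; its gain is $v(S)=\sum_{x\in S}v(x)$. $\mathrm{Opt}(I)$ denotes a solution to $I$ of maximum gain. Online algorithms. An online algorithm maintains a solution ("knapsack"), initially empty. Items arrive one by one in order; when an item $x$ arrives, the algorithm, knowing only the items received so far, may add any number of copies of $x$ and then remove an arbitrary sub-multiset, such that the knapsack is again a valid solution. $\mathrm{Alg}(I)$ denotes the solution held by the algorithm after all of $I$ has been processed. Competitive ratio. A deterministic algorithm Alg is (strictly) $c$-competitive, for a constant $c\ge 1$, if $c\cdot v(\mathrm{Alg}(I))\ge v(\mathrm{Opt}(I))$ for every instance $I$. Its (strict) competitive ratio is the infimum of all $c\ge1$ for which it is $c$-competitive. Notation. $\mathrm{fill}(x)$ is the multiset consisting of $\lfloor 1/w(x)\rfloor$ copies of $x$, and $v^*(x)=v(x)\cdot\lfloor 1/w(x)\rfloor$ is the cumulative value of $x$. Algorithm Focus. Start with $K=\emptyset$. For each arriving item $x$: if $K=\emptyset$, set $K=\mathrm{fill}(x)$;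 otherwise, if $K=\mathrm{fill}(x')$ and $v^*(x)>v^*(x')$, set $K=\mathrm{fill}(x)$; otherwise leave $K$ unchanged. The output is $K$. The sequence $(a_n)_{n\ge1}$ (Sylvester's sequence) is defined by $a_1=2$ and $a_n=1+\prod_{i=1}^{n-1}a_i$ for $n\ge2$. -}

module Defs where

open import Algebra.Bundles using (CommutativeRing)
import Algebra.Definitions.RawMonoid as RawMonoidDefinitions
open import Data.Empty using (⊥-elim)
open import Data.Fin.Base using (toℕ)
open import Data.List.Base using (List; []; _∷_; _++_; _∷ʳ_; foldl; foldr; map; replicate)
open import Data.List.Membership.Propositional using (_∈_)
open import Data.List.Properties using (foldl-∷ʳ; ++-identityʳ)
open import Data.List.Relation.Binary.Permutation.Propositional using (_↭_; ↭-refl; ↭-reflexive)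
open import Data.List.Relation.Unary.All as All using (All; []; _∷_)
import Data.List.Relation.Unary.All.Properties as All
open import Data.Nat.Base as ℕ using (ℕ; zero; suc)
open import Data.Product using (∃; ∃-syntax; _×_; _,_; proj₁; proj₂)
open import Data.Sum.Base using (_⊎_; inj₁; inj₂)
open import Function.Base using (id)
open import Level using (Level; _⊔_) renaming (suc to lsuc)
open import Relation.Binary.Bundles using (DecTotalOrder)
open import Relation.Binary.Core using (Rel)
open import Relation.Binary.PropositionalEquality as ≡ using (_≡_)
import Relation.Binary.Properties.DecTotalOrder as DecTotalOrderProperties
import Relation.Binary.Reasoning.Setoid as SetoidReasoning
open import Relation.Binary.Structures using (IsDecTotalOrder)
open import Relation.Nullary using (¬_; yes; no)
open import Relation.Unary using (Pred)

module Bounds {a ℓ} {A : Set a} (_≤_ : Rel A ℓ) {p} (P : Pred A p) where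

  IsUpperBound IsLowerBound IsSupremum IsInfimum : Pred A (a ⊔ ℓ ⊔ p)
  IsUpperBound b = ∀ x → P x → x ≤ b
  IsLowerBound b = ∀ x → P x → b ≤ x
  IsSupremum   s = IsUpperBound s × (∀ b → IsUpperBound b → s ≤ b)
  IsInfimum    s = IsLowerBound s × (∀ b → IsLowerBound b → b ≤ s)

-- The real numbers, given by their classical characterisation as the complete
-- ordered field.  The order is decidable, as it is classically.  The inverse is
-- a total function whose value at 0# is unconstrained.  The Archimedean axiom
-- follows classically from completeness; it is listed because constructively
-- the other axioms do not provide the witness n.

record CompleteOrderedField c ℓ : Set (lsuc (c ⊔ ℓ)) where
  infix  4 _≤_
  infix  8 _⁻¹
  infixl 7 _/_
  field
    commutativeRing : CommutativeRing c ℓ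

  open CommutativeRing commutativeRing public hiding (zero)
  open RawMonoidDefinitions +-rawMonoid public using (sum) renaming (_×_ to _·_)

  fromℕ : ℕ → Carrier
  fromℕ n = n · 1#

  field
    _≤_             : Rel Carrier ℓ
    isDecTotalOrder : IsDecTotalOrder _≈_ _≤_
    0≉1             : ¬ (0# ≈ 1#)
    _⁻¹             : Carrier → Carrier
    ⁻¹-inverseʳ     : ∀ {x} → ¬ (x ≈ 0#) → x * x ⁻¹ ≈ 1#
    +-monoˡ-≤       : ∀ {x y} z → x ≤ y → x + z ≤ y + z
    *-monoˡ-≤       : ∀ {x y z} → 0# ≤ z → x ≤ y → x * z ≤ y * z

  decTotalOrder : DecTotalOrder c ℓ ℓ
  decTotalOrder = record { isDecTotalOrder = isDecTotalOrder }

  open DecTotalOrder decTotalOrder public using (_≤?_)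
  open DecTotalOrderProperties decTotalOrder public using (_<_)

  _/_ : Carrier → Carrier → Carrier
  x / y = x * y ⁻¹

  open Bounds _≤_ public

  field
    archimedean : ∀ x → ∃[ n ] x ≤ fromℕ n
    complete    : (P : Pred Carrier (c ⊔ ℓ)) → ∃ P → ∃ (IsUpperBound P) → ∃ (IsSupremum P)

  ConvergesTo : (ℕ → Carrier) → Carrier → Set (c ⊔ ℓ)
  ConvergesTo s l = ∀ ε → 0# < ε → ∃[ N ] (∀ n → N ℕ.≤ n → (l - ε < s n) × (s n < l + ε))

  HasSum : (ℕ → Carrier) → Carrier → Set (c ⊔ ℓ)
  HasSum f = ConvergesTo (λ n → sum {n} (λ i → f (toℕ i)))

  floorUpTo : ℕ → Carrier → ℕ
  floorUpTo zero    x = zero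
  floorUpTo (suc n) x with fromℕ (suc n) ≤? x
  ... | yes _ = suc n
  ... | no  _ = floorUpTo n x

  -- The greatest natural number at most x; the usual floor for 0# ≤ x, and 0
  -- for negative x.
  ⌊_⌋ : Carrier → ℕ
  ⌊ x ⌋ = floorUpTo (proj₁ (archimedean x)) x

-- Sylvester's sequence, indexed from 0, so that sylvester n is the (n+1)-st term.
mutual
  sylvester : ℕ → ℕ
  sylvester n = suc (sylvesterProduct n)

  sylvesterProduct : ℕ → ℕ
  sylvesterProduct zero    = 1
  sylvesterProduct (suc n) = sylvesterProduct n ℕ.* sylvester n

module Knapsack {c ℓ : Level} (ℝ : CompleteOrderedField c ℓ) where
  open CompleteOrderedField ℝ

  private
    module ≤ = DecTotalOrder decTotalOrder

  record Item : Set (c ⊔ ℓ) where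
    field
      w   : Carrier
      v   : Carrier
      0<w : 0# < w
      w≤1 : w ≤ 1#
      0<v : 0# < v

  open Item public

  Instance : Set (c ⊔ ℓ)
  Instance = List Item

  -- Lists of items stand for finite multisets: their order is never relevant.
  Multiset : Set (c ⊔ ℓ)
  Multiset = List Item

  weight gain : Multiset → Carrier
  weight S = foldr _+_ 0# (map w S)
  gain   S = foldr _+_ 0# (map v S)

  IsSolution : Instance → Multiset → Set (c ⊔ ℓ)
  IsSolution I S = All (_∈ I) S × weight S ≤ 1#

  IsOptimal : Instance → Multiset → Set (c ⊔ ℓ)
  IsOptimal I S = IsSolution I S × (∀ T → IsSolution I T → gain T ≤ gain S)

  -- K′ arises from K by adding copies of x and then removing a sub-multiset R.
  Update : Item → Multiset → Multiset → Set (c ⊔ ℓ)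
  Update x K K′ = ∃[ k ] ∃[ R ] K′ ++ R ↭ replicate k x ++ K

  -- A deterministic online algorithm, given by the knapsack it holds after each
  -- finite sequence of arrivals; this depends only on the items received so far.
  record OnlineAlgorithm : Set (c ⊔ ℓ) where
    field
      run      : Instance → Multiset
      run-[]   : run [] ≡ []
      update   : ∀ I x → Update x (run I) (run (I ∷ʳ x))
      solution : ∀ I → IsSolution I (run I)

  open OnlineAlgorithm public

  Competitive : OnlineAlgorithm → Carrier → Set (c ⊔ ℓ)
  Competitive A r = ∀ I → ∃[ Opt ] (IsOptimal I Opt × gain Opt ≤ r * gain (run A I))

  IsCompetitiveRatio : OnlineAlgorithm → Carrier → Set (c ⊔ ℓ)
  IsCompetitiveRatio A = IsInfimum (λ r → 1# ≤ r × Competitive A r)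

  copies : Item → ℕ
  copies x = ⌊ 1# / w x ⌋

  fill : Item → Multiset
  fill x = replicate (copies x) x

  v* : Item → Carrier
  v* x = v x * fromℕ (copies x)

  -- A nonempty knapsack is always fill x′ with x′ its first element.
  focusStep : Multiset → Item → Multiset
  focusStep []         x = fill x
  focusStep K@(x′ ∷ _) x with v* x ≤? v* x′
  ... | yes _ = K
  ... | no  _ = fill x

  focus : Instance → Multiset
  focus = foldl focusStep []

  0≤1 : 0# ≤ 1#
  0≤1 = go (≤.total 0# 1#)
    where
    open import Algebra.Properties.Ring ring using (-‿distribˡ-*; -‿involutive)
    go : 0# ≤ 1# ⊎ 1# ≤ 0# → 0# ≤ 1#
    go (inj₁ p) = p
    go (inj₂ p) = ≤.trans (≤.reflexive (sym (zeroˡ (- 1#))))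
                  (≤.trans (*-monoˡ-≤ 0≤-1 0≤-1)
                  (≤.reflexive (trans (sym (-‿distribˡ-* 1# (- 1#)))
                               (trans (-‿cong (*-identityˡ (- 1#))) (-‿involutive 1#)))))
      where
      0≤-1 : 0# ≤ - 1#
      0≤-1 = ≤.trans (≤.reflexive (sym (-‿inverseʳ 1#)))
             (≤.trans (+-monoˡ-≤ (- 1#) p) (≤.reflexive (+-identityˡ (- 1#))))

  0≤⁻¹ : ∀ {x} → 0# < x → 0# ≤ x ⁻¹
  0≤⁻¹ {x} (0≤x , 0≉x) = go (≤.total 0# (x ⁻¹))
    where
    inv : x * x ⁻¹ ≈ 1#
    inv = ⁻¹-inverseʳ (λ e → 0≉x (sym e))
    go : 0# ≤ x ⁻¹ ⊎ x ⁻¹ ≤ 0# → 0# ≤ x ⁻¹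
    go (inj₁ p) = p
    go (inj₂ p) = ⊥-elim (0≉1 (≤.antisym 0≤1
      (≤.trans (≤.reflexive (trans (sym inv) (*-comm x (x ⁻¹))))
      (≤.trans (*-monoˡ-≤ 0≤x p) (≤.reflexive (zeroˡ x))))))

  floorUpTo-≤ : ∀ n {x} → 0# ≤ x → fromℕ (floorUpTo n x) ≤ x
  floorUpTo-≤ zero    0≤x = 0≤x
  floorUpTo-≤ (suc n) {x} 0≤x with fromℕ (suc n) ≤? x
  ... | yes p = p
  ... | no  _ = floorUpTo-≤ n 0≤x

  weight-replicate : ∀ n x → weight (replicate n x) ≈ fromℕ n * w x
  weight-replicate zero    x = sym (zeroˡ (w x))
  weight-replicate (suc n) x = begin
    w x + weight (replicate n x)  ≈⟨ +-cong (*-identityˡ (w x)) (sym (weight-replicate n x)) ⟨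
    1# * w x + fromℕ n * w x      ≈⟨ distribʳ (w x) 1# (fromℕ n) ⟨
    (1# + fromℕ n) * w x          ∎
    where open SetoidReasoning setoid

  fill-weight : ∀ x → weight (fill x) ≤ 1#
  fill-weight x =
    ≤.trans (≤.reflexive (weight-replicate (copies x) x))
    (≤.trans (*-monoˡ-≤ (proj₁ (0<w x)) (floorUpTo-≤ (proj₁ (archimedean (1# / w x))) 0≤1/w))
    (≤.reflexive cancel))
    where
    0≤1/w : 0# ≤ 1# / w x
    0≤1/w = ≤.trans (0≤⁻¹ (0<w x)) (≤.reflexive (sym (*-identityˡ (w x ⁻¹))))
    cancel : (1# / w x) * w x ≈ 1#
    cancel = trans (*-congʳ (*-identityˡ (w x ⁻¹)))
             (trans (*-comm (w x ⁻¹) (w x)) (⁻¹-inverseʳ (λ e → proj₂ (0<w x) (sym e))))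

  fill-solution : ∀ {I x} → x ∈ I → IsSolution I (fill x)
  fill-solution {x = x} x∈I = All.replicate⁺ (copies x) x∈I , fill-weight x

  step-solution : ∀ {I x} K → x ∈ I → IsSolution I K → IsSolution I (focusStep K x)
  step-solution         []       x∈I _ = fill-solution x∈I
  step-solution {x = x} (x′ ∷ _) x∈I s with v* x ≤? v* x′
  ... | yes _ = s
  ... | no  _ = fill-solution x∈I

  foldl-solution : ∀ {I} J K → All (_∈ I) J → IsSolution I K → IsSolution I (foldl focusStep K J)
  foldl-solution []      K []       s = s
  foldl-solution (x ∷ J) K (p ∷ ps) s = foldl-solution J (focusStep K x) ps (step-solution K p s)

  step-update : ∀ K x → Update x K (focusStep K x)
  step-update []         x = copies x , [] , ↭-refl
  step-update K@(x′ ∷ _) x with v* x ≤? v* x′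
  ... | yes _ = 0 , [] , ↭-reflexive (++-identityʳ K)
  ... | no  _ = copies x , K , ↭-refl

  Focus : OnlineAlgorithm
  Focus = record
    { run      = focus
    ; run-[]   = ≡.refl
    ; update   = λ I x → ≡.subst (Update x (focus I)) (≡.sym (foldl-∷ʳ focusStep [] x I))
                           (step-update (focus I) x)
    ; solution = λ I → foldl-solution I [] (All.tabulate id) ([] , 0≤1)
    }

-- Let V be the gain of Focus, the largest cumulative value v* of an item.  An
-- item x with κ copies in fill x is worth at most V / κ and weighs more than
-- 1 / (κ + 1).  Write P_j for the product of the first j Sylvester numbers.  In a
-- multiset of weight at most 1 / P_j every item has κ ≥ P_j.  An item with
-- κ = P_j is worth at most V / P_j, and what remains after removing it weighs at
-- most 1 / P_j − 1 / (P_j + 1) = 1 / P_{j+1}.  If there is no such item, then the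
-- value per weight is at most V (P_j + 2) / (P_j + 1), so that the gain is at most
-- V (1 / P_j + 1 / P_{j+1}).  Both cases stay within V times the tail of the
-- series from index j on, whose terms are 1 / (a_{j+1} − 1) = 1 / P_j.

module Submission where

open import Defs
open import Data.Product using (∃-syntax; _×_)
import Algebra.Properties.Semiring.Mult as SemiringMult
import Algebra.Solver.Ring.NaturalCoefficients.Default as NaturalCoefficientsSolver
open import Data.Fin.Base using (toℕ)
open import Data.List.Base
  using (List; []; _∷_; foldl; foldr; map; replicate; length; filter; cartesianProductWith)
import Data.List.Extrema as Extrema
open import Data.List.Extrema.Nat using (max; xs≤max)
open import Data.List.Membership.Propositional using (_∈_)
open import Data.List.Membership.Propositional.Properties
  using (∈-cartesianProductWith⁺; ∈-cartesianProductWith⁻; ∈-filter⁺; ∈-filter⁻)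
open import Data.List.Properties using (length-removeAt)
open import Data.List.Relation.Unary.All as All using (All; []; _∷_)
import Data.List.Relation.Unary.All.Properties as All
open import Data.List.Relation.Unary.Any as Any using (Any; here; there; any?; _─_)
open import Data.Nat.Base as ℕ using (ℕ; zero; suc; z≤n; s≤s)
import Data.Nat.Properties as ℕ
open import Data.Product using (∃; _,_; proj₁; proj₂)
open import Data.Sum.Base using (inj₁; inj₂)
open import Data.Unit.Polymorphic.Base using (⊤; tt)
open import Level using (_⊔_; Lift; lift)
open import Relation.Binary.Bundles using (DecTotalOrder)
import Relation.Binary.Properties.DecTotalOrder as DecTotalOrderProperties
import Relation.Binary.Reasoning.PartialOrder as PartialOrderReasoning
open import Relation.Binary.PropositionalEquality as ≡ using (_≡_)
open import Relation.Nullary using (¬_; yes; no)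
open import Relation.Unary using (Pred)

-- Ordered-field arithmetic, embedded natural numbers and the floor.

module OrderedField {c ℓ} (ℝ : CompleteOrderedField c ℓ) where
  open CompleteOrderedField ℝ
  open Knapsack ℝ using (0≤1; 0≤⁻¹)

  module ≤ = DecTotalOrder decTotalOrder
  open DecTotalOrderProperties decTotalOrder public
    using (≰⇒>; <⇒≱)
  open PartialOrderReasoning ≤.poset public
  open NaturalCoefficientsSolver commutativeSemiring public
    using (solve; _:=_; _:+_; _:*_; con)

  <⇒≉ʳ : ∀ {x} → 0# < x → ¬ (x ≈ 0#)
  <⇒≉ʳ (_ , 0≉x) x≈0 = 0≉x (sym x≈0)

  0<1 : 0# < 1#
  0<1 = 0≤1 , 0≉1

  +-monoʳ-≤ : ∀ z {x y} → x ≤ y → z + x ≤ z + y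
  +-monoʳ-≤ z {x} {y} x≤y = begin
    z + x  ≈⟨ +-comm z x ⟩
    x + z  ≤⟨ +-monoˡ-≤ z x≤y ⟩
    y + z  ≈⟨ +-comm y z ⟩
    z + y  ∎

  +-mono-≤ : ∀ {x y z t} → x ≤ y → z ≤ t → x + z ≤ y + t
  +-mono-≤ {y = y} {z} x≤y z≤t = ≤.trans (+-monoˡ-≤ z x≤y) (+-monoʳ-≤ y z≤t)

  +-cancelʳ-≤ : ∀ z {x y} → x + z ≤ y + z → x ≤ y
  +-cancelʳ-≤ z {x} {y} p = begin
    x              ≈⟨ undo x ⟨
    (x + z) + - z  ≤⟨ +-monoˡ-≤ (- z) p ⟩
    (y + z) + - z  ≈⟨ undo y ⟩
    y              ∎
    where
    undo : ∀ a → (a + z) + - z ≈ a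
    undo a = trans (+-assoc a z (- z)) (trans (+-congˡ (-‿inverseʳ z)) (+-identityʳ a))

  +-cancelʳ-< : ∀ z {x y} → x + z < y + z → x < y
  +-cancelʳ-< z p = ≰⇒> λ y≤x → <⇒≱ p (+-monoˡ-≤ z y≤x)

  +-monoˡ-< : ∀ z {x y} → x < y → x + z < y + z
  +-monoˡ-< z p = ≰⇒> λ q → <⇒≱ p (+-cancelʳ-≤ z q)

  +-monoʳ-< : ∀ z {x y} → x < y → z + x < z + y
  +-monoʳ-< z {x} {y} x<y = begin-strict
    z + x  ≈⟨ +-comm z x ⟩
    x + z  <⟨ +-monoˡ-< z x<y ⟩
    y + z  ≈⟨ +-comm y z ⟩
    z + y  ∎

  x≤x+y : ∀ {x y} → 0# ≤ y → x ≤ x + y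
  x≤x+y {x} 0≤y = ≤.trans (≤.reflexive (sym (+-identityʳ x))) (+-monoʳ-≤ x 0≤y)

  x≤y+x : ∀ {x y} → 0# ≤ y → x ≤ y + x
  x≤y+x {x} 0≤y = ≤.trans (≤.reflexive (sym (+-identityˡ x))) (+-monoˡ-≤ x 0≤y)

  *-monoʳ-≤ : ∀ {x y z} → 0# ≤ z → x ≤ y → z * x ≤ z * y
  *-monoʳ-≤ {x} {y} {z} 0≤z x≤y = begin
    z * x  ≈⟨ *-comm z x ⟩
    x * z  ≤⟨ *-monoˡ-≤ 0≤z x≤y ⟩
    y * z  ≈⟨ *-comm y z ⟩
    z * y  ∎

  0≤x*y : ∀ {x y} → 0# ≤ x → 0# ≤ y → 0# ≤ x * y
  0≤x*y {y = y} 0≤x 0≤y = ≤.trans (≤.reflexive (sym (zeroˡ y))) (*-monoˡ-≤ 0≤y 0≤x)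

  *-cancelʳ-≤ : ∀ {x y z} → 0# < z → x * z ≤ y * z → x ≤ y
  *-cancelʳ-≤ {x} {y} {z} 0<z p = begin
    x               ≈⟨ undo x ⟨
    (x * z) * z ⁻¹  ≤⟨ *-monoˡ-≤ (0≤⁻¹ 0<z) p ⟩
    (y * z) * z ⁻¹  ≈⟨ undo y ⟩
    y               ∎
    where
    undo : ∀ a → (a * z) * z ⁻¹ ≈ a
    undo a = trans (*-assoc a z (z ⁻¹))
      (trans (*-congˡ (⁻¹-inverseʳ (<⇒≉ʳ 0<z))) (*-identityʳ a))

  *-cancelʳ-< : ∀ {x y z} → 0# ≤ z → x * z < y * z → x < y
  *-cancelʳ-< 0≤z p = ≰⇒> λ y≤x → <⇒≱ p (*-monoˡ-≤ 0≤z y≤x)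

  *-monoˡ-< : ∀ {x y z} → 0# < z → x < y → x * z < y * z
  *-monoˡ-< 0<z x<y = ≰⇒> λ p → <⇒≱ x<y (*-cancelʳ-≤ 0<z p)

  x/y*y≈x : ∀ x {y} → 0# < y → (x / y) * y ≈ x
  x/y*y≈x x {y} 0<y = begin-equality
    (x * y ⁻¹) * y  ≈⟨ *-assoc x (y ⁻¹) y ⟩
    x * (y ⁻¹ * y)  ≈⟨ *-congˡ (trans (*-comm (y ⁻¹) y) (⁻¹-inverseʳ (<⇒≉ʳ 0<y))) ⟩
    x * 1#          ≈⟨ *-identityʳ x ⟩
    x               ∎

  0≤fromℕ : ∀ n → 0# ≤ fromℕ n
  0≤fromℕ zero    = ≤.refl
  0≤fromℕ (suc n) = ≤.trans (0≤fromℕ n) (x≤y+x 0≤1)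

  fromℕ-mono-≤ : ∀ {m n} → m ℕ.≤ n → fromℕ m ≤ fromℕ n
  fromℕ-mono-≤ {n = n} z≤n = 0≤fromℕ n
  fromℕ-mono-≤ (s≤s m≤n)   = +-monoʳ-≤ 1# (fromℕ-mono-≤ m≤n)

  fromℕ-n<1+n : ∀ n → fromℕ n < fromℕ (suc n)
  fromℕ-n<1+n n = begin-strict
    fromℕ n       ≈⟨ +-identityˡ (fromℕ n) ⟨
    0# + fromℕ n  <⟨ +-monoˡ-< (fromℕ n) 0<1 ⟩
    1# + fromℕ n  ∎

  fromℕ-mono-< : ∀ {m n} → m ℕ.< n → fromℕ m < fromℕ n
  fromℕ-mono-< {m} {n} m<n = begin-strict
    fromℕ m        <⟨ fromℕ-n<1+n m ⟩
    fromℕ (suc m)  ≤⟨ fromℕ-mono-≤ m<n ⟩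
    fromℕ n        ∎

  fromℕ-cancel-< : ∀ {m n} → fromℕ m < fromℕ n → m ℕ.< n
  fromℕ-cancel-< p = ℕ.≰⇒> λ n≤m → <⇒≱ p (fromℕ-mono-≤ n≤m)

  fromℕ-cancel-≤ : ∀ {m n} → fromℕ m ≤ fromℕ n → m ℕ.≤ n
  fromℕ-cancel-≤ p = ℕ.≮⇒≥ λ n<m → <⇒≱ (fromℕ-mono-< n<m) p

  0<fromℕ : ∀ n → .{{_ : ℕ.NonZero n}} → 0# < fromℕ n
  0<fromℕ n = fromℕ-mono-< (ℕ.>-nonZero⁻¹ n)

  open SemiringMult semiring public using () renaming (×1-homo-* to fromℕ-homo-*)

  -- `floorUpTo` searches downwards from the Archimedean bound, and each failed test supplies the
  -- strict upper bound with which the search continues.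
  x<1+⌊x⌋ : ∀ x → x < fromℕ (suc ⌊ x ⌋)
  x<1+⌊x⌋ x = go (proj₁ (archimedean x)) (begin-strict
    x                                    ≤⟨ proj₂ (archimedean x) ⟩
    fromℕ (proj₁ (archimedean x))        <⟨ fromℕ-n<1+n (proj₁ (archimedean x)) ⟩
    fromℕ (suc (proj₁ (archimedean x)))  ∎)
    where
    go : ∀ n → x < fromℕ (suc n) → x < fromℕ (suc (floorUpTo n x))
    go zero    p = p
    go (suc n) p with fromℕ (suc n) ≤? x
    ... | yes _ = p
    ... | no  q = go n (≰⇒> q)

  n≤x⇒n≤⌊x⌋ : ∀ n x → fromℕ n ≤ x → n ℕ.≤ ⌊ x ⌋
  n≤x⇒n≤⌊x⌋ n x n≤x = ℕ.≤-pred (fromℕ-cancel-< (begin-strict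
    fromℕ n          ≤⟨ n≤x ⟩
    x                <⟨ x<1+⌊x⌋ x ⟩
    fromℕ (suc ⌊ x ⌋) ∎))

  -- Completeness speaks of suprema: the infimum of `P` is the supremum of its lower bounds, a set
  -- bounded above by any member of `P`.
  infimum : (P : Pred Carrier (c ⊔ ℓ)) → ∃ P → ∃ (IsLowerBound P) → ∃ (IsInfimum P)
  infimum P (x , Px) lowerBound =
    let ρ , ρ-upper , ρ-least = complete (IsLowerBound P) lowerBound (x , λ b bound → bound x Px)
    in  ρ , (λ y Py → ρ-least y λ b bound → bound y Py) , ρ-upper

-- Terms and partial sums of the Sylvester series.

module SylvesterSeries {c ℓ} (ℝ : CompleteOrderedField c ℓ) where
  open CompleteOrderedField ℝ
  open Knapsack ℝ using (0≤1)
  open OrderedField ℝ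

  -- `upper n` is meant as an upper bound for the limit: the terms at least halve at each step, so
  -- the tail from index `n` on is at most twice its first term.
  term partialSum upper product : ℕ → Carrier
  term n       = 1# / (fromℕ (sylvester n) - 1#)
  partialSum n = sum {n} (λ i → term (toℕ i))
  upper n      = partialSum n + (term n + term n)
  product n    = fromℕ (sylvesterProduct n)

  -- Crude growth, enough for the products to be positive and the terms to tend to zero.
  n<sylvesterProduct : ∀ n → n ℕ.< sylvesterProduct n
  n<sylvesterProduct zero    = s≤s z≤n
  n<sylvesterProduct (suc n) = ℕ.≤-trans (s≤s (n<sylvesterProduct n))
    (ℕ.m≤n*m (suc P) P {{ℕ.>-nonZero (ℕ.≤-<-trans z≤n (n<sylvesterProduct n))}})
    where P = sylvesterProduct n

  0<product : ∀ n → 0# < product n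
  0<product n = fromℕ-mono-< (ℕ.≤-<-trans z≤n (n<sylvesterProduct n))

  -- Later computations with `term` go through this division-free form.
  product*term≈1 : ∀ n → product n * term n ≈ 1#
  product*term≈1 n = begin-equality
    product n * (1# * (d ⁻¹))  ≈⟨ *-cong (sym d≈p) (*-identityˡ (d ⁻¹)) ⟩
    d * d ⁻¹                   ≈⟨ ⁻¹-inverseʳ (λ d≈0 → <⇒≉ʳ (0<product n) (trans (sym d≈p) d≈0)) ⟩
    1#                         ∎
    where
    d = fromℕ (sylvester n) - 1#
    d≈p : d ≈ product n
    d≈p = begin-equality
      (1# + product n) - 1#  ≈⟨ +-congʳ (+-comm 1# (product n)) ⟩
      (product n + 1#) - 1#  ≈⟨ +-assoc (product n) 1# (- 1#) ⟩
      product n + (1# - 1#)  ≈⟨ +-congˡ (-‿inverseʳ 1#) ⟩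
      product n + 0#         ≈⟨ +-identityʳ (product n) ⟩
      product n              ∎

  0≤term : ∀ n → 0# ≤ term n
  0≤term n = *-cancelʳ-≤ (0<product n) (begin
    0# * product n      ≈⟨ zeroˡ (product n) ⟩
    0#                  ≤⟨ 0≤1 ⟩
    1#                  ≈⟨ product*term≈1 n ⟨
    product n * term n  ≈⟨ *-comm (product n) (term n) ⟩
    term n * product n  ∎)

  product-suc : ∀ n → product (suc n) ≈ product n * (1# + product n)
  product-suc n = fromℕ-homo-* (sylvesterProduct n) (sylvester n)

  -- Follows from P_{n+1} = P_n (P_n + 1). With the product expanded, this is 1 / P_n = 1 / P_{n+1}
  -- + 1 / (P_n + 1), free of division.
  term-suc : ∀ n → term n ≈ (1# + product n) * term (suc n)
  term-suc n = begin-equality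
    term n                                    ≈⟨ *-identityʳ (term n) ⟨
    term n * 1#                               ≈⟨ *-congˡ (product*term≈1 (suc n)) ⟨
    term n * (product (suc n) * t′)           ≈⟨ *-congˡ (*-congʳ (product-suc n)) ⟩
    term n * ((product n * (1# + product n)) * t′)
      ≈⟨ solve 3 (λ t p t′ → t :* ((p :* (con 1 :+ p)) :* t′) := (p :* t) :* ((con 1 :+ p) :* t′))
           refl (term n) (product n) t′ ⟩
    (product n * term n) * ((1# + product n) * t′)  ≈⟨ *-congʳ (product*term≈1 n) ⟩
    1# * ((1# + product n) * t′)              ≈⟨ *-identityˡ _ ⟩
    (1# + product n) * t′                     ∎
    where t′ = term (suc n)

  partialSum-suc : ∀ n → partialSum (suc n) ≈ partialSum n + term n
  partialSum-suc n = go n term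
    where
    -- `sum` splits off its first summand, so splitting off the last takes an induction over all
    -- `f`, shifted by one each time.
    go : ∀ n (f : ℕ → Carrier) →
         sum {suc n} (λ i → f (toℕ i)) ≈ sum {n} (λ i → f (toℕ i)) + f n
    go zero    f = +-comm (f 0) 0#
    go (suc n) f = trans (+-congˡ (go n (λ i → f (suc i)))) (sym (+-assoc _ _ _))

  partialSum-mono : ∀ {m n} → m ℕ.≤′ n → partialSum m ≤ partialSum n
  partialSum-mono ℕ.≤′-refl = ≤.refl
  partialSum-mono {m} (ℕ.≤′-step {n} m≤n) = begin
    partialSum m           ≤⟨ partialSum-mono m≤n ⟩
    partialSum n           ≤⟨ x≤x+y (0≤term n) ⟩
    partialSum n + term n  ≈⟨ partialSum-suc n ⟨
    partialSum (suc n)     ∎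

  -- The ratio of consecutive terms is 1 + P_n, and P_n is at least 1.
  2term-suc≤term : ∀ n → term (suc n) + term (suc n) ≤ term n
  2term-suc≤term n = begin
    t′ + t′                ≈⟨ solve 1 (λ t′ → t′ :+ t′ := (con 1 :+ con 1) :* t′) refl t′ ⟩
    (1# + 1#) * t′         ≤⟨ *-monoˡ-≤ (0≤term (suc n)) (+-monoʳ-≤ 1# 1≤p) ⟩
    (1# + product n) * t′  ≈⟨ term-suc n ⟨
    term n                 ∎
    where
    t′ = term (suc n)
    1≤p : 1# ≤ product n
    1≤p = begin
      1#         ≈⟨ +-identityʳ 1# ⟨
      fromℕ 1    ≤⟨ fromℕ-mono-≤ (ℕ.≤-<-trans z≤n (n<sylvesterProduct n)) ⟩
      product n  ∎

  -- Of the two extra copies of `term n`, one becomes a summand of the next partial sum and the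
  -- other pays for both copies of `term (suc n)`.
  upper-anti : ∀ {m n} → m ℕ.≤′ n → upper n ≤ upper m
  upper-anti ℕ.≤′-refl = ≤.refl
  upper-anti {m} (ℕ.≤′-step {n} m≤n) = begin
    partialSum (suc n) + (term (suc n) + term (suc n))
      ≤⟨ +-mono-≤ (≤.reflexive (partialSum-suc n)) (2term-suc≤term n) ⟩
    (partialSum n + term n) + term n                    ≈⟨ +-assoc _ _ _ ⟩
    upper n                                             ≤⟨ upper-anti m≤n ⟩
    upper m                                             ∎

  partialSum≤upper-same : ∀ n → partialSum n ≤ upper n
  partialSum≤upper-same n = x≤x+y (≤.trans (0≤term n) (x≤x+y (0≤term n)))

  partialSum≤upper : ∀ m n → partialSum m ≤ upper n
  partialSum≤upper m n with ℕ.≤-total m n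
  ... | inj₁ m≤n = ≤.trans (partialSum-mono (ℕ.≤⇒≤′ m≤n)) (partialSum≤upper-same n)
  ... | inj₂ n≤m = ≤.trans (partialSum≤upper-same m) (upper-anti (ℕ.≤⇒≤′ n≤m))

  -- The limit of the series and its numerical bound.

  IsPartialSum : Pred Carrier (c ⊔ ℓ)
  -- `Lift` brings the predicate to the universe level over which `complete` quantifies.
  IsPartialSum x = ∃[ n ] Lift (c ⊔ ℓ) (x ≈ partialSum n)

  supremum : ∃ (IsSupremum IsPartialSum)
  supremum = complete IsPartialSum (partialSum 0 , 0 , lift refl)
    (upper 0 , λ { x (m , lift x≈s) → ≤.trans (≤.reflexive x≈s) (partialSum≤upper m 0) })

  S∞ : Carrier
  S∞ = proj₁ supremum

  partialSum≤S∞ : ∀ n → partialSum n ≤ S∞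
  partialSum≤S∞ n = proj₁ (proj₂ supremum) (partialSum n) (n , lift refl)

  S∞≤upper : ∀ n → S∞ ≤ upper n
  S∞≤upper n = proj₂ (proj₂ supremum) (upper n)
    λ { x (m , lift x≈s) → ≤.trans (≤.reflexive x≈s) (partialSum≤upper m n) }

  term-0 : term 0 ≈ 1#
  term-0 = begin-equality
    term 0              ≈⟨ *-identityˡ (term 0) ⟨
    1# * term 0         ≈⟨ *-congʳ (+-identityʳ 1#) ⟨
    product 0 * term 0  ≈⟨ product*term≈1 0 ⟩
    1#                  ∎

  1≤S∞ : 1# ≤ S∞
  1≤S∞ = begin
    1#            ≈⟨ term-0 ⟨
    term 0        ≈⟨ +-identityʳ (term 0) ⟨
    partialSum 1  ≤⟨ partialSum≤S∞ 1 ⟩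
    S∞            ∎

  2term<ε : ∀ {ε} → 0# < ε → ∃[ N ] (∀ n → N ℕ.≤ n → term n + term n < ε)
  2term<ε {ε} 0<ε = N , small
    where
    -- With N at least 2 / ε, any n ≥ N has P_n > N, hence 2 / P_n < ε.
    N = proj₁ (archimedean ((1# + 1#) / ε))
    2≤N*ε : 1# + 1# ≤ fromℕ N * ε
    2≤N*ε = begin
      1# + 1#              ≈⟨ x/y*y≈x (1# + 1#) 0<ε ⟨
      ((1# + 1#) / ε) * ε  ≤⟨ *-monoˡ-≤ (proj₁ 0<ε) (proj₂ (archimedean _)) ⟩
      fromℕ N * ε          ∎
    small : ∀ n → N ℕ.≤ n → term n + term n < ε
    small n N≤n = *-cancelʳ-< (proj₁ (0<product n)) (begin-strict
      (term n + term n) * product n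
        ≈⟨ solve 2 (λ t p → (t :+ t) :* p := p :* t :+ p :* t) refl (term n) (product n) ⟩
      product n * term n + product n * term n  ≈⟨ +-cong (product*term≈1 n) (product*term≈1 n) ⟩
      1# + 1#        ≤⟨ 2≤N*ε ⟩
      fromℕ N * ε    <⟨ *-monoˡ-< 0<ε (fromℕ-mono-< (ℕ.≤-<-trans N≤n (n<sylvesterProduct n))) ⟩
      product n * ε  ≈⟨ *-comm (product n) ε ⟩
      ε * product n  ∎)

  -- `S∞` is above every partial sum and below every `upper n`, and these differ by
  -- `term n + term n`, which becomes smaller than ε.
  hasSum : HasSum term S∞
  hasSum ε 0<ε = proj₁ (2term<ε 0<ε) , λ n N≤n → below n N≤n , above n
    where
    above : ∀ n → partialSum n < S∞ + ε
    above n = begin-strict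
      partialSum n  ≤⟨ partialSum≤S∞ n ⟩
      S∞            ≈⟨ +-identityʳ S∞ ⟨
      S∞ + 0#       <⟨ +-monoʳ-< S∞ 0<ε ⟩
      S∞ + ε        ∎
    below : ∀ n → proj₁ (2term<ε 0<ε) ℕ.≤ n → S∞ - ε < partialSum n
    below n N≤n = +-cancelʳ-< ε (begin-strict
      (S∞ - ε) + ε      ≈⟨ +-assoc S∞ (- ε) ε ⟩
      S∞ + (- ε + ε)    ≈⟨ +-congˡ (-‿inverseˡ ε) ⟩
      S∞ + 0#           ≈⟨ +-identityʳ S∞ ⟩
      S∞                ≤⟨ S∞≤upper n ⟩
      upper n           <⟨ +-monoʳ-< (partialSum n) (proj₂ (2term<ε 0<ε) n N≤n) ⟩
      partialSum n + ε  ∎)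

  -- The n-th partial sum is the fraction numerator n / sylvesterProduct n.
  numerator : ℕ → ℕ
  numerator zero    = 0
  numerator (suc n) = suc (numerator n) ℕ.* sylvester n

  partialSum*product : ∀ n → partialSum n * product n ≈ fromℕ (numerator n)
  partialSum*product zero    = zeroˡ (product 0)
  partialSum*product (suc n) = begin-equality
    partialSum (suc n) * product (suc n)  ≈⟨ *-cong (partialSum-suc n) (product-suc n) ⟩
    (s + t) * (p * (1# + p))
      ≈⟨ solve 3 (λ s t p → (s :+ t) :* (p :* (con 1 :+ p)) := (p :* t :+ s :* p) :* (con 1 :+ p)) refl s t p ⟩
    (p * t + s * p) * (1# + p)            ≈⟨ *-congʳ (+-cong (product*term≈1 n) (partialSum*product n)) ⟩
    fromℕ (suc (numerator n)) * (1# + p)  ≈⟨ fromℕ-homo-* (suc (numerator n)) (sylvester n) ⟨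
    fromℕ (numerator (suc n))             ∎
    where
    s = partialSum n
    t = term n
    p = product n

  -- Since `upper n` equals (`numerator n` + 2) / P_n, cross-multiplication reduces the bound to a
  -- comparison of natural numbers.
  S∞<fraction : ∀ n a b → .{{_ : ℕ.NonZero b}} →
    suc (suc (numerator n)) ℕ.* b ℕ.< a ℕ.* sylvesterProduct n → S∞ < fromℕ a / fromℕ b
  S∞<fraction n a b lt = *-cancelʳ-< (proj₁ (0<fromℕ b)) (*-cancelʳ-< (proj₁ (0<product n)) (begin-strict
    (S∞ * fromℕ b) * p              ≤⟨ *-monoˡ-≤ (proj₁ (0<product n)) (*-monoˡ-≤ (0≤fromℕ b) (S∞≤upper n)) ⟩
    (upper n * fromℕ b) * p
      ≈⟨ solve 4 (λ s t b p → ((s :+ (t :+ t)) :* b) :* p := (p :* t :+ (p :* t :+ s :* p)) :* b)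
           refl (partialSum n) (term n) (fromℕ b) p ⟩
    (p * term n + (p * term n + partialSum n * p)) * fromℕ b
      ≈⟨ *-congʳ (+-cong (product*term≈1 n) (+-cong (product*term≈1 n) (partialSum*product n))) ⟩
    fromℕ (suc (suc (numerator n))) * fromℕ b  ≈⟨ fromℕ-homo-* (suc (suc (numerator n))) b ⟨
    fromℕ (suc (suc (numerator n)) ℕ.* b)      <⟨ fromℕ-mono-< lt ⟩
    fromℕ (a ℕ.* sylvesterProduct n)           ≈⟨ fromℕ-homo-* a (sylvesterProduct n) ⟩
    fromℕ a * p                                ≈⟨ *-congʳ (x/y*y≈x (fromℕ a) (0<fromℕ b)) ⟨
    ((fromℕ a / fromℕ b) * fromℕ b) * p        ∎))
    where p = product n

  S∞<1·69104 : S∞ < fromℕ 169104 / fromℕ 100000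
  -- Five terms leave a surplus of 2 / 3263442; after four it is 2 / 1806, too much for this bound.
  S∞<1·69104 = S∞<fraction 5 169104 100000 (ℕ.<ᵇ⇒< _ _ _)

-- Words of bounded length over a finite alphabet.

module _ {a} {A : Set a} where

  wordsUpTo : List A → ℕ → List (List A)
  wordsUpTo xs zero    = [] ∷ []
  wordsUpTo xs (suc n) = [] ∷ cartesianProductWith _∷_ xs (wordsUpTo xs n)

  ∈-wordsUpTo⁺ : ∀ {xs n ys} → All (_∈ xs) ys → length ys ℕ.≤ n → ys ∈ wordsUpTo xs n
  ∈-wordsUpTo⁺ {n = zero}  []         _         = here ≡.refl
  ∈-wordsUpTo⁺ {n = suc n} []         _         = here ≡.refl
  ∈-wordsUpTo⁺ {n = suc n} (y∈ ∷ ys∈) (s≤s len) =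
    there (∈-cartesianProductWith⁺ _∷_ y∈ (∈-wordsUpTo⁺ ys∈ len))

  ∈-wordsUpTo⁻ : ∀ {xs} n {ys} → ys ∈ wordsUpTo xs n → All (_∈ xs) ys
  ∈-wordsUpTo⁻ zero    (here ≡.refl) = []
  ∈-wordsUpTo⁻ (suc n) (here ≡.refl) = []
  ∈-wordsUpTo⁻ {xs} (suc n) (there ys∈)
    with _ , _ , z∈ , zs∈ , ≡.refl ← ∈-cartesianProductWith⁻ _∷_ xs (wordsUpTo xs n) ys∈
    = z∈ ∷ ∈-wordsUpTo⁻ n zs∈

-- Copies per item and existence of optimal solutions.

module KnapsackProperties {c ℓ} (ℝ : CompleteOrderedField c ℓ) where
  open CompleteOrderedField ℝ
  open Knapsack ℝ
  open OrderedField ℝ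
  open SylvesterSeries ℝ
  open Extrema ≤.totalOrder using (argmax; argmax-all; f[xs]≤f[argmax])

  -- The floor κ of 1 / w satisfies 1 / w < κ + 1. This division-free form is the lower bound on
  -- weights used throughout.
  1≤1+copies*w : ∀ x → 1# ≤ fromℕ (suc (copies x)) * w x
  1≤1+copies*w x = begin
    1#                              ≈⟨ x/y*y≈x 1# (0<w x) ⟨
    (1# / w x) * w x                ≤⟨ *-monoˡ-≤ (proj₁ (0<w x)) (proj₁ (x<1+⌊x⌋ (1# / w x))) ⟩
    fromℕ (suc (copies x)) * w x    ∎

  n*w≤1⇒n≤copies : ∀ n x → fromℕ n * w x ≤ 1# → n ℕ.≤ copies x
  n*w≤1⇒n≤copies n x n*w≤1 = n≤x⇒n≤⌊x⌋ n (1# / w x) (*-cancelʳ-≤ (0<w x) (begin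
    fromℕ n * w x     ≤⟨ n*w≤1 ⟩
    1#                ≈⟨ x/y*y≈x 1# (0<w x) ⟨
    (1# / w x) * w x  ∎))

  module _ (f : Item → Carrier) where

    -- `weight` and `gain` are definitionally the cases `w` and `v`; the constant `1#` counts items.
    total : Multiset → Carrier
    total S = foldr _+_ 0# (map f S)

    total-─ : ∀ {p} {P : Pred Item p} {S} (i : Any P S) → total S ≈ f (Any.lookup i) + total (S ─ i)
    total-─ (here _)                = refl
    total-─ {S = x ∷ S} (there i) = begin-equality
      f x + total S            ≈⟨ +-congˡ (total-─ i) ⟩
      f x + (f y + total S′)   ≈⟨ solve 3 (λ a b c → a :+ (b :+ c) := b :+ (a :+ c)) refl (f x) (f y) (total S′) ⟩
      f y + (f x + total S′)   ∎
      where
      y  = Any.lookup i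
      S′ = S ─ i

    module _ (0≤f : ∀ x → 0# ≤ f x) where

      0≤total : ∀ S → 0# ≤ total S
      0≤total []      = ≤.refl
      0≤total (x ∷ S) = ≤.trans (0≤f x) (x≤x+y (0≤total S))

      ≤total : ∀ S → All (λ x → f x ≤ total S) S
      ≤total []      = []
      ≤total (x ∷ S) =
        x≤x+y (0≤total S) ∷ All.map (λ fy≤ → ≤.trans fy≤ (x≤y+x (0≤f x))) (≤total S)

  total-mono : ∀ {f g : Item → Carrier} {a} {S} → All (λ x → f x ≤ a * g x) S → total f S ≤ a * total g S
  total-mono {a = a} []       = ≤.reflexive (sym (zeroʳ a))
  total-mono {a = a} (p ∷ ps) =
    ≤.trans (+-mono-≤ p (total-mono ps)) (≤.reflexive (sym (distribˡ a _ _)))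

  fromℕ-length : ∀ S → fromℕ (length S) ≈ total (λ _ → 1#) S
  fromℕ-length []      = refl
  fromℕ-length (_ ∷ S) = +-congˡ (fromℕ-length S)

  0≤gain : ∀ S → 0# ≤ gain S
  0≤gain = 0≤total v (λ x → proj₁ (0<v x))

  maxCopies : Instance → ℕ
  maxCopies I = max 0 (map copies I)

  -- Every item of `I` weighs at least 1 / N for N = `suc (maxCopies I)`, so at most N of them fit.
  solution-length : ∀ {I S} → IsSolution I S → length S ℕ.≤ suc (maxCopies I)
  solution-length {I} {S} (S⊆I , S≤1) = fromℕ-cancel-≤ (begin
    fromℕ (length S)     ≈⟨ fromℕ-length S ⟩
    total (λ _ → 1#) S   ≤⟨ total-mono (All.map heavy S⊆I) ⟩
    fromℕ N * weight S   ≤⟨ *-monoʳ-≤ (0≤fromℕ N) S≤1 ⟩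
    fromℕ N * 1#         ≈⟨ *-identityʳ (fromℕ N) ⟩
    fromℕ N              ∎)
    where
    N = suc (maxCopies I)
    heavy : ∀ {x} → x ∈ I → 1# ≤ fromℕ N * w x
    heavy {x} x∈I = ≤.trans (1≤1+copies*w x)
      (*-monoˡ-≤ (proj₁ (0<w x))
        (fromℕ-mono-≤ (s≤s (All.lookup (All.map⁻ (xs≤max 0 (map copies I))) x∈I))))

  -- Exhaustive search: by `solution-length` all solutions occur in the finite list `candidates`.
  -- The default `[]` of `argmax` is itself a solution.
  optimum : ∀ I → ∃[ S ] IsOptimal I S
  optimum I =
      argmax gain [] candidates
    , argmax-all gain ([] , 0≤1) (All.tabulate λ S∈ →
        let S∈words , S≤1 = ∈-filter⁻ light? {xs = words} S∈
        in  ∈-wordsUpTo⁻ N S∈words , S≤1)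
    , λ T sol → All.lookup (f[xs]≤f[argmax] [] candidates)
        (∈-filter⁺ light? (∈-wordsUpTo⁺ (proj₁ sol) (solution-length sol)) (proj₂ sol))
    where
    N          = suc (maxCopies I)
    words      = wordsUpTo I N
    light?     = λ S → weight S ≤? 1#
    candidates = filter light? words

  -- The gain of Focus dominates every cumulative value.

  gain-fill : ∀ x → gain (fill x) ≈ v* x
  gain-fill x = go (copies x)
    where
    go : ∀ n → gain (replicate n x) ≈ v x * fromℕ n
    go zero    = sym (zeroʳ (v x))
    go (suc n) = begin-equality
      v x + gain (replicate n x)  ≈⟨ +-cong (sym (*-identityʳ (v x))) (go n) ⟩
      v x * 1# + v x * fromℕ n    ≈⟨ distribˡ (v x) 1# (fromℕ n) ⟨
      v x * (1# + fromℕ n)        ∎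

  -- A consequence of being fill x that suffices to follow the gain of Focus.
  FullOfHead : Multiset → Set ℓ
  FullOfHead []      = ⊤
  FullOfHead (x ∷ K) = gain (x ∷ K) ≈ v* x

  fill-full : ∀ x → FullOfHead (fill x)
  fill-full x = go (copies x) (gain-fill x)
    where
    -- Replacing `copies x` by a variable allows the case split on which `FullOfHead` reduces.
    go : ∀ n → gain (replicate n x) ≈ v* x → FullOfHead (replicate n x)
    go zero    _ = tt
    go (suc _) e = e

  focusStep-full : ∀ K x → FullOfHead K → FullOfHead (focusStep K x)
  focusStep-full []      x _ = fill-full x
  focusStep-full (y ∷ _) x e with v* x ≤? v* y
  ... | yes _ = e
  ... | no  _ = fill-full x

  -- Focus replaces its knapsack only for a larger `v*`, and `FullOfHead` identifies the gain with
  -- the `v*` being compared.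
  gain≤gain-focusStep : ∀ K x → FullOfHead K → gain K ≤ gain (focusStep K x)
  gain≤gain-focusStep []        x _ = 0≤gain (fill x)
  gain≤gain-focusStep K@(y ∷ _) x e with v* x ≤? v* y
  ... | yes _ = ≤.refl
  ... | no  p = begin
    gain K         ≈⟨ e ⟩
    v* y           ≤⟨ proj₁ (≰⇒> p) ⟩
    v* x           ≈⟨ gain-fill x ⟨
    gain (fill x)  ∎

  v*≤gain-focusStep : ∀ K x → FullOfHead K → v* x ≤ gain (focusStep K x)
  v*≤gain-focusStep []      x _ = ≤.reflexive (sym (gain-fill x))
  v*≤gain-focusStep (y ∷ _) x e with v* x ≤? v* y
  ... | yes p = ≤.trans p (≤.reflexive (sym e))
  ... | no  _ = ≤.reflexive (sym (gain-fill x))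

  gain≤gain-foldl : ∀ K J → FullOfHead K → gain K ≤ gain (foldl focusStep K J)
  gain≤gain-foldl K []      _ = ≤.refl
  gain≤gain-foldl K (x ∷ J) e = ≤.trans (gain≤gain-focusStep K x e)
    (gain≤gain-foldl (focusStep K x) J (focusStep-full K x e))

  -- Right after the arrival of an item the gain is at least its `v*`, and it never drops later.
  v*≤gain-foldl : ∀ K J → FullOfHead K → All (λ x → v* x ≤ gain (foldl focusStep K J)) J
  v*≤gain-foldl K []      _ = []
  v*≤gain-foldl K (x ∷ J) e =
      ≤.trans (v*≤gain-focusStep K x e) (gain≤gain-foldl (focusStep K x) J e′)
    ∷ v*≤gain-foldl (focusStep K x) J e′
    where e′ = focusStep-full K x e

  v*≤gain-focus : ∀ I → All (λ x → v* x ≤ gain (focus I)) I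
  v*≤gain-focus I = v*≤gain-foldl [] I tt

  -- Bounding the gain of an arbitrary solution.

  sylvesterProduct≤copies : ∀ j x → w x ≤ term j → sylvesterProduct j ℕ.≤ copies x
  sylvesterProduct≤copies j x w≤t = n*w≤1⇒n≤copies (sylvesterProduct j) x (begin
    product j * w x     ≤⟨ *-monoʳ-≤ (0≤fromℕ (sylvesterProduct j)) w≤t ⟩
    product j * term j  ≈⟨ product*term≈1 j ⟩
    1#                  ∎)

  -- `p * t′` is 1 / (P_j + 1), a lower bound for `w x` since κ = P_j. By `term-suc`, taking it from
  -- `term j` leaves `term (suc j)`.
  remainder≤term-suc : ∀ j x R → copies x ≡ sylvesterProduct j → w x + R ≤ term j → R ≤ term (suc j)
  remainder≤term-suc j x R κ≡P w+R≤t = +-cancelʳ-≤ (p * t′) (begin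
    R + p * t′      ≤⟨ +-monoʳ-≤ R pt′≤w ⟩
    R + w x         ≈⟨ +-comm R (w x) ⟩
    w x + R         ≤⟨ w+R≤t ⟩
    term j          ≈⟨ term-suc j ⟩
    (1# + p) * t′   ≈⟨ solve 2 (λ p t′ → (con 1 :+ p) :* t′ := t′ :+ p :* t′) refl p t′ ⟩
    t′ + p * t′     ∎)
    where
    p  = product j
    t′ = term (suc j)
    pt′≤w : p * t′ ≤ w x
    pt′≤w = begin
      p * t′                             ≈⟨ *-identityʳ (p * t′) ⟨
      (p * t′) * 1#                      ≤⟨ *-monoʳ-≤ (0≤x*y (0≤fromℕ (sylvesterProduct j)) (0≤term (suc j))) (1≤1+copies*w x) ⟩
      (p * t′) * (fromℕ (suc (copies x)) * w x)
        ≡⟨ ≡.cong (λ k → (p * t′) * (fromℕ (suc k) * w x)) κ≡P ⟩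
      (p * t′) * ((1# + p) * w x)
        ≈⟨ solve 3 (λ p t′ w → (p :* t′) :* ((con 1 :+ p) :* w) := ((p :* (con 1 :+ p)) :* t′) :* w) refl p t′ (w x) ⟩
      ((p * (1# + p)) * t′) * w x        ≈⟨ *-congʳ (*-congʳ (product-suc j)) ⟨
      (product (suc j) * t′) * w x       ≈⟨ *-congʳ (product*term≈1 (suc j)) ⟩
      1# * w x                           ≈⟨ *-identityˡ (w x) ⟩
      w x                                ∎

  module _ {V} (0≤V : 0# ≤ V) where

    -- With κ = copies x and w > 1 / (κ + 1), the density v / w is below
    -- V (κ + 1) / κ, which is at most V (p + 2) / (p + 1) as p + 1 ≤ κ.
    density : ∀ j x → v* x ≤ V → sylvester j ℕ.≤ copies x →
              v x ≤ (V * (1# + product j * term (suc j))) * w x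
    density j x v*≤V P<κ = *-cancelʳ-≤ 0<1+p (begin
      v x * (1# + p)                                   ≈⟨ *-identityʳ _ ⟨
      (v x * (1# + p)) * 1#                            ≤⟨ *-monoʳ-≤ (0≤x*y (proj₁ (0<v x)) (proj₁ 0<1+p)) (1≤1+copies*w x) ⟩
      (v x * (1# + p)) * ((1# + κ) * w x)
        ≈⟨ solve 4 (λ v p κ w → (v :* (con 1 :+ p)) :* ((con 1 :+ κ) :* w)
                             := (v :* w) :* ((con 1 :+ p) :+ (con 1 :+ p) :* κ)) refl (v x) p κ (w x) ⟩
      (v x * w x) * ((1# + p) + (1# + p) * κ)          ≤⟨ *-monoʳ-≤ (0≤x*y (proj₁ (0<v x)) (proj₁ (0<w x)))
                                                            (+-monoˡ-≤ ((1# + p) * κ) (fromℕ-mono-≤ P<κ)) ⟩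
      (v x * w x) * (κ + (1# + p) * κ)
        ≈⟨ solve 4 (λ v p κ w → (v :* w) :* (κ :+ (con 1 :+ p) :* κ)
                             := (v :* κ) :* (w :* (con 1 :+ (con 1 :+ p)))) refl (v x) p κ (w x) ⟩
      (v x * κ) * (w x * (1# + (1# + p)))              ≤⟨ *-monoˡ-≤ (0≤x*y (proj₁ (0<w x)) (0≤fromℕ (suc (sylvester j)))) v*≤V ⟩
      V * (w x * (1# + (1# + p)))                      ≈⟨ *-congˡ (*-congˡ (+-congʳ (sym p*t′*1+p≈1))) ⟩
      V * (w x * ((p * t′) * (1# + p) + (1# + p)))
        ≈⟨ solve 4 (λ V p t′ w → V :* (w :* ((p :* t′) :* (con 1 :+ p) :+ (con 1 :+ p)))
                             := ((V :* (con 1 :+ p :* t′)) :* w) :* (con 1 :+ p)) refl V p t′ (w x) ⟩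
      ((V * (1# + p * t′)) * w x) * (1# + p)           ∎)
      where
      p  = product j
      t′ = term (suc j)
      κ  = fromℕ (copies x)
      0<1+p : 0# < 1# + p
      0<1+p = 0<fromℕ (sylvester j)
      p*t′*1+p≈1 : (p * t′) * (1# + p) ≈ 1#
      p*t′*1+p≈1 = begin-equality
        (p * t′) * (1# + p)  ≈⟨ solve 2 (λ p t′ → (p :* t′) :* (con 1 :+ p) := p :* ((con 1 :+ p) :* t′)) refl p t′ ⟩
        p * ((1# + p) * t′)  ≈⟨ *-congˡ (term-suc j) ⟨
        p * term j           ≈⟨ product*term≈1 j ⟩
        1#                   ∎

    -- Multiply the value per weight from `density` by the weight limit: as P_j times `term j` is 1,
    -- the product is exactly V times two consecutive terms.
    gain-without-exact-items : ∀ j {T} → All (λ x → v* x ≤ V) T → All (λ x → sylvester j ℕ.≤ copies x) T →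
      weight T ≤ term j → gain T ≤ V * (term j + term (suc j))
    gain-without-exact-items j {T} v*≤V large T≤t = begin
      gain T                            ≤⟨ total-mono (All.zipWith (λ { {x} (p , q) → density j x p q }) (v*≤V , large)) ⟩
      (V * (1# + p * t′)) * weight T    ≤⟨ *-monoʳ-≤ (0≤x*y 0≤V 0≤1+pt′) T≤t ⟩
      (V * (1# + p * t′)) * t
        ≈⟨ solve 4 (λ V p t t′ → (V :* (con 1 :+ p :* t′)) :* t := V :* (t :+ (p :* t) :* t′)) refl V p t t′ ⟩
      V * (t + (p * t) * t′)            ≈⟨ *-congˡ (+-congˡ (trans (*-congʳ (product*term≈1 j)) (*-identityˡ t′))) ⟩
      V * (t + t′)                      ∎
      where
      p  = product j
      t  = term j
      t′ = term (suc j)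
      0≤1+pt′ : 0# ≤ 1# + p * t′
      0≤1+pt′ = ≤.trans 0≤1 (x≤x+y (0≤x*y (0≤fromℕ (sylvesterProduct j)) (0≤term (suc j))))

    v≤V*term : ∀ j x → v* x ≤ V → copies x ≡ sylvesterProduct j → v x ≤ V * term j
    v≤V*term j x v*≤V κ≡P = begin
      v x                         ≈⟨ *-identityʳ (v x) ⟨
      v x * 1#                    ≈⟨ *-congˡ (product*term≈1 j) ⟨
      v x * (product j * term j)  ≈⟨ *-assoc (v x) (product j) (term j) ⟨
      (v x * product j) * term j  ≡⟨ ≡.cong (λ k → (v x * fromℕ k) * term j) κ≡P ⟨
      v* x * term j               ≤⟨ *-monoˡ-≤ (0≤term j) v*≤V ⟩
      V * term j                  ∎

    -- This bounds `gain T` by V times the tail from j on, with the partial sum moved to the left to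
    -- avoid subtraction. An item with κ = P_j is charged to `term j` and j advances; if there is
    -- none, two terms pay for all of `T`. The recursion runs on the length bound `n`, because
    -- `T ─ i` is no structural part of `T`.
    gain-bound : ∀ n j T → length T ℕ.≤ n → All (λ x → v* x ≤ V) T → weight T ≤ term j →
                 gain T + V * partialSum j ≤ V * S∞
    gain-bound n j [] _ _ _ = begin
      0# + V * partialSum j  ≈⟨ +-identityˡ _ ⟩
      V * partialSum j       ≤⟨ *-monoʳ-≤ 0≤V (partialSum≤S∞ j) ⟩
      V * S∞                 ∎
    gain-bound (suc n) j T@(_ ∷ _) len v*≤V T≤t with any? (λ x → copies x ℕ.≟ sylvesterProduct j) T
    ... | yes i = begin
      gain T + V * s              ≈⟨ +-congʳ (total-─ v i) ⟩
      (v x + gain T′) + V * s     ≤⟨ +-monoˡ-≤ (V * s) (+-monoˡ-≤ (gain T′) (v≤V*term j x v*x≤V κ≡P)) ⟩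
      (V * term j + gain T′) + V * s
        ≈⟨ solve 4 (λ V t g s → (V :* t :+ g) :+ V :* s := g :+ V :* (s :+ t)) refl V (term j) (gain T′) s ⟩
      gain T′ + V * (s + term j)  ≈⟨ +-congˡ (*-congˡ (partialSum-suc j)) ⟨
      gain T′ + V * partialSum (suc j)
        ≤⟨ gain-bound n (suc j) T′ len′ (All.─⁺ i v*≤V)
             (remainder≤term-suc j x (weight T′) κ≡P (≤.trans (≤.reflexive (sym (total-─ w i))) T≤t)) ⟩
      V * S∞                      ∎
      where
      s     = partialSum j
      x     = Any.lookup i
      T′    = T ─ i
      v*x≤V = proj₁ (All.lookupAny v*≤V i)
      κ≡P   = proj₂ (All.lookupAny v*≤V i)
      len′ : length T′ ℕ.≤ n
      len′ = ≡.subst (ℕ._≤ n) (≡.sym (length-removeAt T (Any.index i))) (ℕ.pred-mono-≤ len)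
    ... | no ∄ = begin
      gain T + V * s              ≤⟨ +-monoˡ-≤ (V * s) (gain-without-exact-items j v*≤V large T≤t) ⟩
      V * (t + t′) + V * s        ≈⟨ solve 4 (λ V t t′ s → V :* (t :+ t′) :+ V :* s := V :* ((s :+ t) :+ t′)) refl V t t′ s ⟩
      V * ((s + t) + t′)          ≈⟨ *-congˡ (trans (partialSum-suc (suc j)) (+-congʳ (partialSum-suc j))) ⟨
      V * partialSum (suc (suc j)) ≤⟨ *-monoʳ-≤ 0≤V (partialSum≤S∞ (suc (suc j))) ⟩
      V * S∞                      ∎
      where
      s  = partialSum j
      t  = term j
      t′ = term (suc j)
      -- The weight gives κ ≥ P_j and equality is excluded; `sylvester j` is by definition P_j + 1,
      -- so the strict inequality is the claim.
      large : All (λ x → sylvester j ℕ.≤ copies x) T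
      large = All.zipWith
        (λ { {x} (w≤T , κ≢P) →
          ℕ.≤∧≢⇒< (sylvesterProduct≤copies j x (≤.trans w≤T T≤t)) (λ P≡κ → κ≢P (≡.sym P≡κ)) })
        (≤total w (λ x → proj₁ (0<w x)) T , All.¬Any⇒All¬ T ∄)

  -- `gain-bound` at j = 0, where the partial sum is empty and `term 0` is the capacity 1, with V
  -- the gain of Focus.
  gain-solution : ∀ {I T} → IsSolution I T → gain T ≤ S∞ * gain (focus I)
  gain-solution {I} {T} (T⊆I , T≤1) = begin
    gain T                     ≈⟨ +-identityʳ (gain T) ⟨
    gain T + 0#                ≈⟨ +-congˡ (zeroʳ V) ⟨
    gain T + V * partialSum 0  ≤⟨ gain-bound (0≤gain (focus I)) (length T) 0 T ℕ.≤-refl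
                                    (All.map (All.lookup (v*≤gain-focus I)) T⊆I)
                                    (≤.trans T≤1 (≤.reflexive (sym term-0))) ⟩
    V * S∞                     ≈⟨ *-comm V S∞ ⟩
    S∞ * V                     ∎
    where V = gain (focus I)

  focus-competitive : Competitive Focus S∞
  focus-competitive I with Opt , optimal ← optimum I = Opt , optimal , gain-solution (proj₁ optimal)

-- The competitive ratio of Focus.

theorem2 : ∀ {c ℓ} (ℝ : CompleteOrderedField c ℓ) →
    let open CompleteOrderedField ℝ
        open Knapsack ℝ
    in ∃[ S∞ ] ( HasSum (λ n → 1# / (fromℕ (sylvester n) - 1#)) S∞
               × S∞ < fromℕ 169104 / fromℕ 100000
               × ∃[ ρ ] (IsCompetitiveRatio Focus ρ × ρ ≤ S∞) )
theorem2 ℝ = S∞ , hasSum , S∞<1·69104 , proj₁ ratio , proj₂ ratio , proj₁ (proj₂ ratio) S∞ attained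
  where
  open CompleteOrderedField ℝ
  open Knapsack ℝ
  open OrderedField ℝ using (infimum)
  open SylvesterSeries ℝ
  open KnapsackProperties ℝ
  attained : 1# ≤ S∞ × Competitive Focus S∞
  attained = 1≤S∞ , focus-competitive
  -- The admissible constants include `S∞` and are bounded below by 1, so they have an infimum, and
  -- it is at most `S∞`.
  ratio : ∃ (IsCompetitiveRatio Focus)
  ratio = infimum _ (S∞ , attained) (1# , λ _ → proj₁)
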